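{- Let $G$ be a clustered graph on $mn$ vertices with clusters $C_i=\{v_{i,1},\dots,v_{i,m}\}$, $i=1,\dots,n$, satisfying the following two conditions. (1) (Commuting condition) For all $i_1,j_1,i_2,j_2\in\{1,\dots,n\}$ and all $\alpha,\beta\in\{1,\dots,m\}$, $$\left|\mathrm{nbd}_{C_{j_1}}(v_{i_1,\alpha})\cap \mathrm{nbd}_{C_{i_2}}(v_{j_2,\beta})\right| = \left|\mathrm{nbd}_{C_{i_1}}(v_{j_1,\beta})\cap \mathrm{nbd}_{C_{j_2}}(v_{i_2,\alpha})\right|.$$ (2) (Normality condition) For all $i\neq j$ and all $\alpha,\beta\in\{1,\dots,m\}$, the number of common neighbours in $C_j$ of $v_{i,\alpha}$ and $v_{i,\beta}$ equals the number of common neighbours in $C_i$ of $v_{j,\alpha}$ and $v_{j,\beta}$. Then $G$ and its graph theoretical partial transpose $G^\tau$ are cospectral.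
   Context: All graphs are finite, simple and undirected. A clustered graph on $mn$ vertices with clusters $C_i=\{v_{i,1},\dots,v_{i,m}\}$, $i=1,\dots,n$, is a graph whose labelled vertex set is partitioned into these clusters. For a vertex $v_{i,\alpha}$ and a cluster $C_j$, $\mathrm{nbd}_{C_j}(v_{i,\alpha})=\{\beta\in\{1,\dots,m\} : v_{i,\alpha}\text{ and } v_{j,\beta}\text{ are adjacent}\}$. The graph theoretical partial transpose $G^\tau$ is the graph on the same vertex set obtained from $G$ by keeping every edge inside a cluster and every edge of the form $(v_{i,k},v_{j,k})$, and replacing every edge $(v_{i,k},v_{j,l})$ with $i\neq j$, $k\neq l$ by the edge $(v_{i,l},v_{j,k})$; equivalently, if the adjacency matrix of $G$ is the block matrix $[A_{i,j}]$ with $(A_{i,j})_{\alpha\beta}=1$ iff $v_{i,\alpha}\sim v_{j,\beta}$, then the adjacency matrix of $G^\tau$ is $[A_{i,j}^t]$. Cospectral means the adjacency matrices have the same multiset of eigenvalues. -}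

module Defs where

open import Data.Bool using (Bool; true; false; if_then_else_)
open import Data.Nat using (ℕ; zero; suc; _*_)
open import Data.Nat.Properties using (_≟_)
open import Data.Integer as ℤ using (ℤ; +_; -_)
open import Data.List using (List; []; _∷_)
open import Data.Fin as Fin using (Fin; zero; suc; punchIn; remQuot; toℕ)
open import Data.Fin.Subset using (Subset; _∩_; ∣_∣)
open import Data.Vec using (tabulate)
open import Data.Product using (_×_; _,_; proj₁; proj₂)
open import Relation.Binary.PropositionalEquality using (_≡_)
open import Relation.Nullary using (¬_; does)

-- Clustered graphs
-- Vertex (i , α) : Fin n × Fin m stands for v_{i,α} (cluster i, position α).

Vertex : ℕ → ℕ → Set
Vertex n m = Fin n × Fin m

record ClusteredGraph (n m : ℕ) : Set where
  field
    adj     : Vertex n m → Vertex n m → Bool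
    adj-sym : ∀ u v → adj u v ≡ adj v u
    adj-irr : ∀ v → adj v v ≡ false
open ClusteredGraph public

nbd : ∀ {n m} → ClusteredGraph n m → Fin n → Vertex n m → Subset m
nbd G j v = tabulate (λ β → adj G v (j , β))

-- Graph theoretical partial transpose: v_{i,α} ~τ v_{j,β} iff v_{i,β} ~ v_{j,α}
-- (adjacency matrix [A_{i,j}^t]).
partialTranspose : ∀ {n m} → ClusteredGraph n m → ClusteredGraph n m
partialTranspose G = record
  { adj     = λ { (i , α) (j , β) → adj G (i , β) (j , α) }
  ; adj-sym = λ { (i , α) (j , β) → adj-sym G (i , β) (j , α) }
  ; adj-irr = λ { (i , α) → adj-irr G (i , α) }
  }

-- Integer polynomials, coefficient lists (constant term first)

Poly : Set
Poly = List ℤ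

infixl 6 _+ₚ_
infixl 7 _*ₚ_

_+ₚ_ : Poly → Poly → Poly
[]      +ₚ q       = q
p       +ₚ []      = p
(a ∷ p) +ₚ (b ∷ q) = (a ℤ.+ b) ∷ (p +ₚ q)

scaleₚ : ℤ → Poly → Poly
scaleₚ c []      = []
scaleₚ c (a ∷ p) = (c ℤ.* a) ∷ scaleₚ c p

_*ₚ_ : Poly → Poly → Poly
[]      *ₚ q = []
(a ∷ p) *ₚ q = scaleₚ a q +ₚ (+ 0 ∷ (p *ₚ q))

negₚ : Poly → Poly
negₚ = scaleₚ (- + 1)

coeff : Poly → ℕ → ℤ
coeff []      k       = + 0
coeff (a ∷ p) zero    = a
coeff (a ∷ p) (suc k) = coeff p k

Matrix : Set → ℕ → Set
Matrix A N = Fin N → Fin N → A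

even : ℕ → Bool
even zero          = true
even (suc zero)    = false
even (suc (suc k)) = even k

sumₚ : ∀ {N} → (Fin N → Poly) → Poly
sumₚ {zero}  f = []
sumₚ {suc N} f = f zero +ₚ sumₚ (λ j → f (suc j))

det : ∀ {N} → Matrix Poly N → Poly
det {zero}  M = + 1 ∷ []
det {suc N} M = sumₚ (λ j →
  let term = M zero j *ₚ det (λ r c → M (suc r) (punchIn j c))
  in if even (toℕ j) then term else negₚ term)

charPoly : ∀ {N} → Matrix ℤ N → Poly
charPoly A = det (λ r c →
  if does (toℕ r ≟ toℕ c) then (ℤ.- A r c) ∷ + 1 ∷ [] else (ℤ.- A r c) ∷ [])

-- Cospectral: same characteristic polynomial (= same multiset of eigenvalues)
Cospectral : ∀ {N} → Matrix ℤ N → Matrix ℤ N → Set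
Cospectral A B = ∀ k → coeff (charPoly A) k ≡ coeff (charPoly B) k

-- Adjacency matrix of a clustered graph: row/column index k ∈ Fin (n*m)
-- corresponds to v_{i,α} with (i , α) = remQuot m k, i.e. the block
-- ordering [A_{i,j}].

b2ℤ : Bool → ℤ
b2ℤ true  = + 1
b2ℤ false = + 0

adjMatrix : ∀ {n m} → ClusteredGraph n m → Matrix ℤ (n * m)
adjMatrix {n} {m} G k l = b2ℤ (adj G (remQuot m k) (remQuot m l))

CommutingCondition : ∀ {n m} → ClusteredGraph n m → Set
CommutingCondition {n} {m} G =
  ∀ (i₁ j₁ i₂ j₂ : Fin n) (α β : Fin m) →
    ∣ nbd G j₁ (i₁ , α) ∩ nbd G i₂ (j₂ , β) ∣
      ≡ ∣ nbd G i₁ (j₁ , β) ∩ nbd G j₂ (i₂ , α) ∣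

NormalityCondition : ∀ {n m} → ClusteredGraph n m → Set
NormalityCondition {n} {m} G =
  ∀ (i j : Fin n) → ¬ (i ≡ j) → ∀ (α β : Fin m) →
    ∣ nbd G j (i , α) ∩ nbd G j (i , β) ∣
      ≡ ∣ nbd G i (j , α) ∩ nbd G i (j , β) ∣

{-# OPTIONS --safe #-}
module Submission where

open import Defs
open import Data.Bool.Base using (Bool; true; false; if_then_else_)
open import Data.Fin.Base using (Fin; zero; suc; toℕ; punchIn; lift; _↑ˡ_; _↑ʳ_; combine; quotient; remainder)
open import Data.Fin.Properties using (remQuot-combine) renaming (_≟_ to _≟ᶠ_)
open import Data.Fin.Subset using (_∩_) renaming (∣_∣ to size)
open import Data.Integer.Base using (ℤ; 0ℤ; 1ℤ; -1ℤ; _+_; _*_; -_; _-_; ≢-nonZero)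
  renaming (+_ to pos; ∣_∣ to abs)
open import Data.Integer.Properties
open import Data.Integer.Tactic.RingSolver using (solve-∀)
open import Data.List.Base using ([]; _∷_)
open import Data.Nat.Base as ℕ using (ℕ; zero; suc; z≤n; s≤s)
open import Data.Nat.Divisibility using (divides; >⇒∤)
import Data.Nat.Properties as ℕ
open import Data.Product.Base using (_,_; ∃; proj₁; proj₂)
open import Data.Sum.Base using (inj₁; inj₂)
open import Data.Vec.Base using (tabulate)
open import Data.Vec.Functional using (updateAt)
open import Data.Vec.Functional.Properties
  using (updateAt-updates; updateAt-minimal; updateAt-id-local; map-updateAt)
open import Function.Base using (_∘_; const; flip)
open import Relation.Binary.PropositionalEquality
open import Relation.Nullary using (does; yes; no; contradiction)

open import Algebra.Properties.Semiring.Sum +-*-semiring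
  using (sum; sum-cong-≗; sum-replicate-zero; ∑-distrib-+; ∑-comm; *-distribˡ-sum; *-distribʳ-sum)

open ≡-Reasoning

-- The commuting condition says that all blocks A_ij of the adjacency matrix A commute, so the
-- blocks of (A^τ)^k are the transposes of those of A^k, and tr (A^τ)^k = tr A^k.
-- Equal power traces force equal characteristic polynomials: with R(t) = det (xI − tA) and
-- B = adj (xI − tA), the numbers b_k = tr (A^(k+1) B) satisfy x b_k = t b_(k+1) + R tr A^(k+1).
-- For a second matrix with the same traces (data S, c_k), d_k = S b_k − R c_k therefore
-- satisfies x d_k = t d_(k+1). If t = u x with an integer u ≥ 2, then u^k divides d_0 for
-- all k, so d_0 = 0. Since R′ = − b_0 and S′ = − c_0, this is R′ S = R S′ at infinitely
-- many t; together with R(0) = S(0) ≠ 0 it gives R = S, and evaluating at t = 1 gives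
-- det (xI − A) for every positive integer x.

-- Finite sums and the Kronecker delta

sum-zero : ∀ {n} {f : Fin n → ℤ} → (∀ i → f i ≡ 0ℤ) → sum f ≡ 0ℤ
sum-zero {n} f≗0 = trans (sum-cong-≗ f≗0) (sum-replicate-zero n)

sum-scale : ∀ {n} a (f : Fin n → ℤ) → sum (λ i → a * f i) ≡ a * sum f
sum-scale a f = sym (*-distribˡ-sum a f)

sum-neg : ∀ {n} (f : Fin n → ℤ) → sum (λ i → - f i) ≡ - sum f
sum-neg f = trans (sum-cong-≗ λ i → sym (-1*i≡-i (f i))) (trans (sum-scale -1ℤ f) (-1*i≡-i (sum f)))

sum-linear-comm : ∀ {m n} (a : Fin m → ℤ) (f : Fin m → Fin n → ℤ) →
  sum (λ j → sum λ i → a i * f i j) ≡ sum λ i → a i * sum (f i)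
sum-linear-comm a f = trans (∑-comm λ j i → a i * f i j) (sum-cong-≗ λ i → sum-scale (a i) (f i))

-- Tested through `toℕ` exactly as the diagonal in `charPoly`, so that `eval-charPoly` can treat
-- both by one case split on the same Boolean.
δ : ∀ {n} → Fin n → Fin n → ℤ
δ i j = if does (toℕ i ℕ.≟ toℕ j) then 1ℤ else 0ℤ

sum-δ : ∀ {n} (v : Fin n → ℤ) k → sum (λ j → v j * δ j k) ≡ v k
sum-δ v zero    = trans (cong₂ _+_ (*-identityʳ (v zero)) (sum-zero λ j → *-zeroʳ (v (suc j)))) (+-identityʳ (v zero))
sum-δ v (suc k) = trans (cong₂ _+_ (*-zeroʳ (v zero)) (sum-δ (v ∘ suc) k)) (+-identityˡ (v (suc k)))

δ-refl : ∀ {n} (i : Fin n) → δ i i ≡ 1ℤ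
δ-refl zero    = refl
δ-refl (suc i) = δ-refl i

δ-≢ : ∀ {n} (i j : Fin n) → i ≢ j → δ i j ≡ 0ℤ
δ-≢ zero    zero    i≢j = contradiction refl i≢j
δ-≢ zero    (suc j) i≢j = refl
δ-≢ (suc i) zero    i≢j = refl
δ-≢ (suc i) (suc j) i≢j = δ-≢ i j (i≢j ∘ cong suc)

-- Determinants of integer matrices

sgn : ℕ → ℤ
sgn k = if even k then 1ℤ else -1ℤ

sgn-suc : ∀ k → sgn (suc k) ≡ - sgn k
sgn-suc zero          = refl
sgn-suc (suc zero)    = refl
sgn-suc (suc (suc k)) = sgn-suc k

minor : ∀ {A : Set} {N} → Fin (suc N) → Matrix A (suc N) → Matrix A N
minor j M r c = M (suc r) (punchIn j c)

-- The first-row Laplace expansion of `det`, with the sign as a factor, so that `eval-det` matches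
-- the two term by term.
detℤ : ∀ {N} → Matrix ℤ N → ℤ
detℤ {zero}  M = 1ℤ
detℤ {suc N} M = sum λ j → sgn (toℕ j) * (M zero j * detℤ (minor j M))

detℤ-cong : ∀ {N} {M M′ : Matrix ℤ N} → (∀ r → M r ≗ M′ r) → detℤ M ≡ detℤ M′
detℤ-cong {zero}  M≗M′ = refl
detℤ-cong {suc N} M≗M′ = sum-cong-≗ λ j → cong (sgn (toℕ j) *_)
  (cong₂ _*_ (M≗M′ zero j) (detℤ-cong λ r c → M≗M′ (suc r) (punchIn j c)))


setRow : ∀ {R} {B : Set} → (Fin R → B) → Fin R → B → Fin R → B
setRow M k v = updateAt M k (const v)

setRow-cong : ∀ {R C} (M : Fin R → Fin C → ℤ) k {v w : Fin C → ℤ} → v ≗ w →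
  ∀ r → setRow M k v r ≗ setRow M k w r
setRow-cong M zero    v≗w zero    c = v≗w c
setRow-cong M zero    v≗w (suc r) c = refl
setRow-cong M (suc k) v≗w zero    c = refl
setRow-cong M (suc k) v≗w (suc r) c = setRow-cong (M ∘ suc) k v≗w r c

detℤ-minor-setRow : ∀ {N} (M : Matrix ℤ (suc N)) j k (v : Fin (suc N) → ℤ) →
  detℤ (minor j (setRow M (suc k) v)) ≡ detℤ (setRow (minor j M) k (v ∘ punchIn j))
detℤ-minor-setRow M j k v = detℤ-cong λ r →
  cong-app (map-updateAt {f = _∘ punchIn j} (λ _ → refl) (M ∘ suc) k r)

-- In the expansion along row zero each entry of that row occurs linearly; a later row is handled
-- inside the minors by induction. Combinations of any length are allowed so that `detℤ-setRow` can
-- expand a row in the unit vectors in one step.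
detℤ-row-linear : ∀ {K N} (M : Matrix ℤ N) k (a : Fin K → ℤ) (V : Fin K → Fin N → ℤ) →
  detℤ (setRow M k λ c → sum λ i → a i * V i c) ≡ sum λ i → a i * detℤ (setRow M k (V i))
detℤ-row-linear {N = suc N} M zero a V = begin
  sum (λ j → sgn (toℕ j) * (sum (λ i → a i * V i j) * D j))
    ≡⟨ sum-cong-≗ (λ j → trans (arrange (sgn (toℕ j)) (sum λ i → a i * V i j) (D j))
         (trans (*-distribˡ-sum (sgn (toℕ j) * D j) (λ i → a i * V i j))
           (sum-cong-≗ λ i → distribute (sgn (toℕ j)) (a i) (V i j) (D j)))) ⟩
  sum (λ j → sum λ i → a i * (sgn (toℕ j) * (V i j * D j)))
    ≡⟨ sum-linear-comm a (λ i j → sgn (toℕ j) * (V i j * D j)) ⟩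
  sum (λ i → a i * sum λ j → sgn (toℕ j) * (V i j * D j)) ∎
  where
  D : Fin (suc N) → ℤ
  D j = detℤ (minor j M)
  arrange : ∀ s x d → s * (x * d) ≡ s * d * x
  arrange = solve-∀
  distribute : ∀ s x y d → s * d * (x * y) ≡ x * (s * (y * d))
  distribute = solve-∀
detℤ-row-linear {N = suc N} M (suc k) a V = begin
  sum (λ j → sgn (toℕ j) * (M zero j * detℤ (minor j (setRow M (suc k) λ c → sum λ i → a i * V i c))))
    ≡⟨ sum-cong-≗ (λ j → cong (λ z → sgn (toℕ j) * (M zero j * z))
         (trans (detℤ-minor-setRow M j k λ c → sum λ i → a i * V i c)
           (detℤ-row-linear (minor j M) k a λ i → V i ∘ punchIn j))) ⟩
  sum (λ j → sgn (toℕ j) * (M zero j * sum λ i → a i * D i j))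
    ≡⟨ sum-cong-≗ (λ j → trans (sym (*-assoc (sgn (toℕ j)) (M zero j) (sum λ i → a i * D i j)))
         (trans (*-distribˡ-sum (sgn (toℕ j) * M zero j) (λ i → a i * D i j))
           (sum-cong-≗ λ i → distribute (sgn (toℕ j)) (M zero j) (a i) (D i j)))) ⟩
  sum (λ j → sum λ i → a i * (sgn (toℕ j) * (M zero j * D i j)))
    ≡⟨ sum-linear-comm a (λ i j → sgn (toℕ j) * (M zero j * D i j)) ⟩
  sum (λ i → a i * sum λ j → sgn (toℕ j) * (M zero j * D i j))
    ≡⟨ sum-cong-≗ (λ i → cong (a i *_) (sum-cong-≗ λ j →
         cong (λ z → sgn (toℕ j) * (M zero j * z)) (detℤ-minor-setRow M j k (V i)))) ⟨
  sum (λ i → a i * detℤ (setRow M (suc k) (V i))) ∎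
  where
  D : _ → Fin (suc N) → ℤ
  D i j = detℤ (setRow (minor j M) k (V i ∘ punchIn j))
  distribute : ∀ s m x d → s * m * (x * d) ≡ x * (s * (m * d))
  distribute = solve-∀

-- The double Laplace expansion along two rows with entries h j l in columns j ≠ l;
-- c ↦ g c is the complementary minor on the columns c.
twoRowExpansion : ∀ {K} → (h : Fin (suc (suc K)) → Fin (suc (suc K)) → ℤ) →
  ((Fin K → Fin (suc (suc K))) → ℤ) → ℤ
twoRowExpansion h g = sum λ j → sum λ k →
  sgn (toℕ j) * sgn (toℕ k) * (h j (punchIn j k) * g (punchIn j ∘ punchIn k))

-- Terms using column zero form a border. Choosing column zero second instead of first costs one
-- sign, so the borders of `h` and `flip h` cancel; the terms avoiding column zero are a smaller
-- instance. As `g` takes functions, its respect for pointwise equality has to be assumed.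
twoRowExpansion-antisym : ∀ {K} h (g : (Fin K → Fin (suc (suc K))) → ℤ) →
  (∀ {c c′} → c ≗ c′ → g c ≡ g c′) →
  twoRowExpansion h g + twoRowExpansion (flip h) g ≡ 0ℤ
twoRowExpansion-antisym {K} h g g-cong = begin
  twoRowExpansion h g + twoRowExpansion (flip h) g
    ≡⟨ cong₂ _+_ (split h) (split (flip h)) ⟩
  (border h + (- border (flip h) + inner h)) + (border (flip h) + (- border h + inner (flip h)))
    ≡⟨ cancel (border h) (border (flip h)) (inner h) (inner (flip h)) ⟩
  inner h + inner (flip h)
    ≡⟨ inner-antisym K h g g-cong ⟩
  0ℤ ∎
  where
  border inner : (Fin (suc (suc K)) → Fin (suc (suc K)) → ℤ) → ℤ
  border h = sum λ k → 1ℤ * sgn (toℕ k) * (h zero (suc k) * g (suc ∘ punchIn k))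
  inner h = sum λ j → sum λ k → sgn (suc (toℕ j)) * sgn (suc (toℕ k)) *
    (h (suc j) (suc (punchIn j k)) * g (punchIn (suc j) ∘ punchIn (suc k)))

  negate : ∀ s x → - s * 1ℤ * x ≡ - (1ℤ * s * x)
  negate = solve-∀

  cancel : ∀ a b x y → (a + (- b + x)) + (b + (- a + y)) ≡ x + y
  cancel = solve-∀

  split : ∀ h → twoRowExpansion h g ≡ border h + (- border (flip h) + inner h)
  split h = cong (λ z → border h + z) (begin
    (sum λ j → sgn (suc (toℕ j)) * 1ℤ * (h (suc j) zero * g (suc ∘ punchIn j)) + innerSum j)
      ≡⟨ ∑-distrib-+ (λ j → sgn (suc (toℕ j)) * 1ℤ * (h (suc j) zero * g (suc ∘ punchIn j))) innerSum ⟩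
    (sum λ j → sgn (suc (toℕ j)) * 1ℤ * (h (suc j) zero * g (suc ∘ punchIn j))) + inner h
      ≡⟨ cong (_+ inner h) (sum-cong-≗ λ j →
           trans (cong (λ s → s * 1ℤ * (h (suc j) zero * g (suc ∘ punchIn j))) (sgn-suc (toℕ j)))
             (negate (sgn (toℕ j)) (h (suc j) zero * g (suc ∘ punchIn j)))) ⟩
    (sum λ j → - (1ℤ * sgn (toℕ j) * (h (suc j) zero * g (suc ∘ punchIn j)))) + inner h
      ≡⟨ cong (_+ inner h) (sum-neg λ j → 1ℤ * sgn (toℕ j) * (h (suc j) zero * g (suc ∘ punchIn j))) ⟩
    - border (flip h) + inner h ∎)
    where
    innerSum : Fin (suc K) → ℤ
    innerSum j = sum λ k → sgn (suc (toℕ j)) * sgn (suc (toℕ k)) *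
      (h (suc j) (suc (punchIn j k)) * g (punchIn (suc j) ∘ punchIn (suc k)))

  inner-antisym : ∀ K h (g : (Fin K → Fin (suc (suc K))) → ℤ) →
    (∀ {c c′} → c ≗ c′ → g c ≡ g c′) →
    let inner = λ h → sum λ j → sum λ k → sgn (suc (toℕ j)) * sgn (suc (toℕ k)) *
          (h (suc j) (suc (punchIn j k)) * g (punchIn (suc j) ∘ punchIn (suc k)))
    in inner h + inner (flip h) ≡ 0ℤ
  inner-antisym zero    h g g-cong = refl
  -- Both signs change on passing from `suc` indices to their predecessors, so their product is
  -- kept, and the remaining column map fixes zero: it is `lift 1` of the smaller one.
  inner-antisym (suc K) h g g-cong = trans (cong₂ _+_ (shift h) (shift (flip h)))
    (twoRowExpansion-antisym (λ j k → h (suc j) (suc k)) (g ∘ lift 1) (g-cong ∘ lift-cong))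
    where
    lift-cong : ∀ {m n} {c c′ : Fin m → Fin n} → c ≗ c′ → lift 1 c ≗ lift 1 c′
    lift-cong c≗c′ zero    = refl
    lift-cong c≗c′ (suc i) = cong suc (c≗c′ i)

    punchIn-lift : ∀ {n} (j : Fin (suc (suc n))) k →
      punchIn (suc j) ∘ punchIn (suc k) ≗ lift 1 (punchIn j ∘ punchIn k)
    punchIn-lift j k zero    = refl
    punchIn-lift j k (suc i) = refl

    neg-cancel : ∀ s s′ → - s * - s′ ≡ s * s′
    neg-cancel = solve-∀

    shift : ∀ h → (sum λ j → sum λ k → sgn (suc (toℕ j)) * sgn (suc (toℕ k)) *
        (h (suc j) (suc (punchIn j k)) * g (punchIn (suc j) ∘ punchIn (suc k))))
      ≡ twoRowExpansion (λ j k → h (suc j) (suc k)) (g ∘ lift 1)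
    shift h = sum-cong-≗ λ j → sum-cong-≗ λ k → cong₂ _*_
      (trans (cong₂ _*_ (sgn-suc (toℕ j)) (sgn-suc (toℕ k))) (neg-cancel (sgn (toℕ j)) (sgn (toℕ k))))
      (cong (h (suc j) (suc (punchIn j k)) *_) (g-cong (punchIn-lift j k)))

swapFirstTwo : ∀ {A : Set} {N} → Matrix A (suc (suc N)) → Matrix A (suc (suc N))
swapFirstTwo M zero          = M (suc zero)
swapFirstTwo M (suc zero)    = M zero
swapFirstTwo M (suc (suc r)) = M (suc (suc r))

-- Expanding along the first two rows, the swap flips the products of their entries and leaves the
-- complementary minors alone, so the antisymmetry of the double expansion applies.
detℤ-swapFirstTwo : ∀ {N} (M : Matrix ℤ (suc (suc N))) → detℤ M + detℤ (swapFirstTwo M) ≡ 0ℤ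
detℤ-swapFirstTwo {N} M = trans
  (cong₂ _+_ (expand M)
    (trans (expand (swapFirstTwo M)) (sum-cong-≗ λ j → sum-cong-≗ λ k →
      cong (λ z → sgn (toℕ j) * sgn (toℕ k) * (z * rest (punchIn j ∘ punchIn k))) (*-comm (M (suc zero) j) (M zero (punchIn j k))))))
  (twoRowExpansion-antisym {N} (λ j l → M zero j * M (suc zero) l) rest
    λ c≗c′ → detℤ-cong λ r i → cong (M (suc (suc r))) (c≗c′ i))
  where
  rest : (Fin N → Fin (suc (suc N))) → ℤ
  rest c = detℤ λ r i → M (suc (suc r)) (c i)

  arrange : ∀ s m s′ m′ d → s * m * (s′ * (m′ * d)) ≡ s * s′ * (m * m′ * d)
  arrange = solve-∀

  expand : ∀ (M : Matrix ℤ (suc (suc N))) → detℤ M ≡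
    twoRowExpansion (λ j l → M zero j * M (suc zero) l) (λ c → detℤ λ r i → M (suc (suc r)) (c i))
  expand M = sum-cong-≗ λ j → trans (sym (*-assoc (sgn (toℕ j)) (M zero j) _))
    (trans (*-distribˡ-sum (sgn (toℕ j) * M zero j) (λ k → sgn (toℕ k) * (M (suc zero) (punchIn j k) * detℤ (minor k (minor j M)))))
      (sum-cong-≗ λ k → arrange (sgn (toℕ j)) (M zero j) (sgn (toℕ k)) (M (suc zero) (punchIn j k)) (detℤ (minor k (minor j M)))))

x+x≡0⇒x≡0 : ∀ x → x + x ≡ 0ℤ → x ≡ 0ℤ
x+x≡0⇒x≡0 x x+x≡0 = *-cancelʳ-≡ x 0ℤ (pos 2) (trans (double x) x+x≡0)
  where
  double : ∀ x → x * pos 2 ≡ x + x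
  double = solve-∀

zeroMinors⇒detℤ≡0 : ∀ {N} (M : Matrix ℤ (suc N)) → (∀ j → detℤ (minor j M) ≡ 0ℤ) → detℤ M ≡ 0ℤ
zeroMinors⇒detℤ≡0 M minors≡0 = sum-zero λ j → trans
  (cong (λ z → sgn (toℕ j) * (M zero j * z)) (minors≡0 j))
  (trans (cong (sgn (toℕ j) *_) (*-zeroʳ (M zero j))) (*-zeroʳ (sgn (toℕ j))))

-- If the second row is the copy, swapping changes nothing and the determinant is its own negative.
-- Otherwise the swap moves the first row into the minors, where it is the first row again and its
-- copy is one place nearer.
detℤ-firstRowRepeated : ∀ {N} (M : Matrix ℤ (suc N)) k → M zero ≗ M (suc k) → detℤ M ≡ 0ℤ
detℤ-firstRowRepeated {suc N} M zero eq = x+x≡0⇒x≡0 (detℤ M) (trans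
  (cong (detℤ M +_) (detℤ-cong unchanged)) (detℤ-swapFirstTwo M))
  where
  unchanged : ∀ r → M r ≗ swapFirstTwo M r
  unchanged zero          = eq
  unchanged (suc zero)    = sym ∘ eq
  unchanged (suc (suc r)) = λ _ → refl
detℤ-firstRowRepeated {suc N} M (suc k) eq = begin
  detℤ M                          ≡⟨ +-identityʳ (detℤ M) ⟨
  detℤ M + 0ℤ                     ≡⟨ cong (λ z → detℤ M + z) (zeroMinors⇒detℤ≡0 (swapFirstTwo M) λ j →
                                       detℤ-firstRowRepeated (minor j (swapFirstTwo M)) k (eq ∘ punchIn j)) ⟨
  detℤ M + detℤ (swapFirstTwo M)  ≡⟨ detℤ-swapFirstTwo M ⟩
  0ℤ                              ∎

detℤ-rowRepeated : ∀ {N} (M : Matrix ℤ N) i k → i ≢ k → M i ≗ M k → detℤ M ≡ 0ℤ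
detℤ-rowRepeated M zero    zero    i≢k eq = contradiction refl i≢k
detℤ-rowRepeated M zero    (suc k) i≢k eq = detℤ-firstRowRepeated M k eq
detℤ-rowRepeated M (suc i) zero    i≢k eq = detℤ-firstRowRepeated M i (sym ∘ eq)
detℤ-rowRepeated M (suc i) (suc k) i≢k eq = zeroMinors⇒detℤ≡0 M λ j →
  detℤ-rowRepeated (minor j M) i k (i≢k ∘ cong suc) (eq ∘ punchIn j)

-- Cramer's rule: the (j, k) entry of the adjugate is det M with row k replaced by e_j.
adjugate : ∀ {N} → Matrix ℤ N → Matrix ℤ N
adjugate M j k = detℤ (setRow M k (δ j))

detℤ-setRow : ∀ {N} (M : Matrix ℤ N) k v → detℤ (setRow M k v) ≡ sum λ j → v j * adjugate M j k
detℤ-setRow M k v = trans (detℤ-cong (setRow-cong M k λ c → sym (sum-δ v c))) (detℤ-row-linear M k v δ)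

-- The sum is the determinant of `M` with row `k` overwritten by row `i`: this is `M` itself when
-- `i` equals `k`, and a matrix with two equal rows otherwise.
*-adjugate : ∀ {N} (M : Matrix ℤ N) i k → sum (λ j → M i j * adjugate M j k) ≡ δ i k * detℤ M
*-adjugate M i k with i ≟ᶠ k
... | yes refl = begin
  sum (λ j → M i j * adjugate M j i)  ≡⟨ detℤ-setRow M i (M i) ⟨
  detℤ (setRow M i (M i))             ≡⟨ detℤ-cong (λ r → cong-app (updateAt-id-local i M refl r)) ⟩
  detℤ M                              ≡⟨ *-identityˡ (detℤ M) ⟨
  1ℤ * detℤ M                         ≡⟨ cong (_* detℤ M) (δ-refl i) ⟨
  δ i i * detℤ M                      ∎
... | no i≢k = begin
  sum (λ j → M i j * adjugate M j k)  ≡⟨ detℤ-setRow M k (M i) ⟨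
  detℤ (setRow M k (M i))             ≡⟨ detℤ-rowRepeated (setRow M k (M i)) i k i≢k (cong-app
                                           (trans (updateAt-minimal i k M i≢k) (sym (updateAt-updates k M)))) ⟩
  0ℤ * detℤ M                         ≡⟨ cong (_* detℤ M) (δ-≢ i k i≢k) ⟨
  δ i k * detℤ M                      ∎

-- Polynomials as functions on ℤ

eval : Poly → ℤ → ℤ
eval []      x = 0ℤ
eval (a ∷ p) x = a + x * eval p x

-- The value of the formal derivative, by the product rule (a + xp)′ = p + xp′.
deriv : Poly → ℤ → ℤ
deriv []      x = 0ℤ
deriv (a ∷ p) x = eval p x + x * deriv p x

eval-+ : ∀ p q x → eval (p +ₚ q) x ≡ eval p x + eval q x
eval-+ []      q       x = sym (+-identityˡ (eval q x))
eval-+ (a ∷ p) []      x = sym (+-identityʳ (eval (a ∷ p) x))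
eval-+ (a ∷ p) (b ∷ q) x = trans (cong (λ z → a + b + x * z) (eval-+ p q x))
  (arrange a b x (eval p x) (eval q x))
  where
  arrange : ∀ a b x y z → a + b + x * (y + z) ≡ (a + x * y) + (b + x * z)
  arrange = solve-∀

deriv-+ : ∀ p q x → deriv (p +ₚ q) x ≡ deriv p x + deriv q x
deriv-+ []      q       x = sym (+-identityˡ (deriv q x))
deriv-+ (a ∷ p) []      x = sym (+-identityʳ (deriv (a ∷ p) x))
deriv-+ (a ∷ p) (b ∷ q) x = trans (cong₂ (λ y z → y + x * z) (eval-+ p q x) (deriv-+ p q x))
  (arrange x (eval p x) (eval q x) (deriv p x) (deriv q x))
  where
  arrange : ∀ x y z y′ z′ → y + z + x * (y′ + z′) ≡ (y + x * y′) + (z + x * z′)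
  arrange = solve-∀

eval-scale : ∀ c p x → eval (scaleₚ c p) x ≡ c * eval p x
eval-scale c []      x = sym (*-zeroʳ c)
eval-scale c (a ∷ p) x = trans (cong (λ z → c * a + x * z) (eval-scale c p x)) (arrange c a x (eval p x))
  where
  arrange : ∀ c a x y → c * a + x * (c * y) ≡ c * (a + x * y)
  arrange = solve-∀

deriv-scale : ∀ c p x → deriv (scaleₚ c p) x ≡ c * deriv p x
deriv-scale c []      x = sym (*-zeroʳ c)
deriv-scale c (a ∷ p) x = trans (cong₂ (λ y z → y + x * z) (eval-scale c p x) (deriv-scale c p x))
  (arrange c x (eval p x) (deriv p x))
  where
  arrange : ∀ c x y y′ → c * y + x * (c * y′) ≡ c * (y + x * y′)
  arrange = solve-∀

eval-* : ∀ p q x → eval (p *ₚ q) x ≡ eval p x * eval q x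
eval-* []      q x = refl
eval-* (a ∷ p) q x = begin
  eval (scaleₚ a q +ₚ (0ℤ ∷ (p *ₚ q))) x           ≡⟨ eval-+ (scaleₚ a q) (0ℤ ∷ (p *ₚ q)) x ⟩
  eval (scaleₚ a q) x + (0ℤ + x * eval (p *ₚ q) x)
    ≡⟨ cong₂ (λ y z → y + (0ℤ + x * z)) (eval-scale a q x) (eval-* p q x) ⟩
  a * eval q x + (0ℤ + x * (eval p x * eval q x))  ≡⟨ arrange a x (eval p x) (eval q x) ⟩
  (a + x * eval p x) * eval q x                    ∎
  where
  arrange : ∀ a x y z → a * z + (0ℤ + x * (y * z)) ≡ (a + x * y) * z
  arrange = solve-∀

deriv-* : ∀ p q x → deriv (p *ₚ q) x ≡ deriv p x * eval q x + eval p x * deriv q x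
deriv-* []      q x = refl
deriv-* (a ∷ p) q x = begin
  deriv (scaleₚ a q +ₚ (0ℤ ∷ (p *ₚ q))) x
    ≡⟨ deriv-+ (scaleₚ a q) (0ℤ ∷ (p *ₚ q)) x ⟩
  deriv (scaleₚ a q) x + (eval (p *ₚ q) x + x * deriv (p *ₚ q) x)
    ≡⟨ cong₂ _+_ (deriv-scale a q x) (cong₂ (λ y z → y + x * z) (eval-* p q x) (deriv-* p q x)) ⟩
  a * deriv q x + (eval p x * eval q x + x * (deriv p x * eval q x + eval p x * deriv q x))
    ≡⟨ arrange a x (eval p x) (eval q x) (deriv p x) (deriv q x) ⟩
  (eval p x + x * deriv p x) * eval q x + (a + x * eval p x) * deriv q x ∎
  where
  arrange : ∀ a x y z y′ z′ → a * z′ + (y * z + x * (y′ * z + y * z′)) ≡ (y + x * y′) * z + (a + x * y) * z′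
  arrange = solve-∀

eval-sumₚ : ∀ {n} (f : Fin n → Poly) x → eval (sumₚ f) x ≡ sum λ j → eval (f j) x
eval-sumₚ {zero}  f x = refl
eval-sumₚ {suc n} f x = trans (eval-+ (f zero) (sumₚ (f ∘ suc)) x)
  (cong (λ z → eval (f zero) x + z) (eval-sumₚ (f ∘ suc) x))

deriv-sumₚ : ∀ {n} (f : Fin n → Poly) x → deriv (sumₚ f) x ≡ sum λ j → deriv (f j) x
deriv-sumₚ {zero}  f x = refl
deriv-sumₚ {suc n} f x = trans (deriv-+ (f zero) (sumₚ (f ∘ suc)) x)
  (cong (λ z → deriv (f zero) x + z) (deriv-sumₚ (f ∘ suc) x))

signed : Bool → Poly → Poly
signed b p = if b then p else negₚ p

eval-signed : ∀ b p x → eval (signed b p) x ≡ (if b then 1ℤ else -1ℤ) * eval p x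
eval-signed true  p x = sym (*-identityˡ (eval p x))
eval-signed false p x = eval-scale -1ℤ p x

deriv-signed : ∀ b p x → deriv (signed b p) x ≡ (if b then 1ℤ else -1ℤ) * deriv p x
deriv-signed true  p x = sym (*-identityˡ (deriv p x))
deriv-signed false p x = deriv-scale -1ℤ p x

evalMatrix derivMatrix : ∀ {N} → Matrix Poly N → ℤ → Matrix ℤ N
evalMatrix  M x r c = eval (M r c) x
derivMatrix M x r c = deriv (M r c) x

eval-det : ∀ {N} (M : Matrix Poly N) x → eval (det M) x ≡ detℤ (evalMatrix M x)
eval-det {zero}  M x = cong (1ℤ +_) (*-zeroʳ x)
eval-det {suc N} M x = trans (eval-sumₚ (λ j → signed (even (toℕ j)) (M zero j *ₚ det (minor j M))) x)
  (sum-cong-≗ λ j → trans (eval-signed (even (toℕ j)) (M zero j *ₚ det (minor j M)) x)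
    (cong (sgn (toℕ j) *_) (trans (eval-* (M zero j) (det (minor j M)) x)
      (cong (eval (M zero j) x *_) (eval-det (minor j M) x)))))

-- The product rule on each Laplace term differentiates either the entry of row zero or the minor;
-- by induction the latter is a sum over the remaining rows, each differentiated in turn.
deriv-det : ∀ {N} (M : Matrix Poly N) x →
  deriv (det M) x ≡ sum λ k → detℤ (setRow (evalMatrix M x) k (derivMatrix M x k))
deriv-det {zero}  M x = cong (0ℤ +_) (*-zeroʳ x)
deriv-det {suc N} M x = begin
  deriv (det M) x
    ≡⟨ deriv-sumₚ (λ j → signed (even (toℕ j)) (M zero j *ₚ det (minor j M))) x ⟩
  (sum λ j → deriv (signed (even (toℕ j)) (M zero j *ₚ det (minor j M))) x)
    ≡⟨ sum-cong-≗ productRule ⟩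
  (sum λ j → firstRow j + sum λ k → otherRow k j)
    ≡⟨ ∑-distrib-+ firstRow (λ j → sum λ k → otherRow k j) ⟩
  sum firstRow + (sum λ j → sum λ k → otherRow k j)
    ≡⟨ cong (λ z → sum firstRow + z) (∑-comm λ j k → otherRow k j) ⟩
  sum firstRow + (sum λ k → sum λ j → otherRow k j)
    ≡⟨ cong (λ z → sum firstRow + z) (sum-cong-≗ λ k → sum-cong-≗ λ j →
         cong (λ z → sgn (toℕ j) * (E zero j * z)) (detℤ-minor-setRow E j k (D (suc k)))) ⟨
  (sum λ k → detℤ (setRow E k (D k))) ∎
  where
  E = evalMatrix M x
  D = derivMatrix M x

  firstRow : Fin (suc N) → ℤ
  firstRow j = sgn (toℕ j) * (D zero j * detℤ (minor j E))

  otherRow : Fin N → Fin (suc N) → ℤ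
  otherRow k j = sgn (toℕ j) * (E zero j * detℤ (setRow (minor j E) k (D (suc k) ∘ punchIn j)))

  expand : ∀ s d m e m′ → s * (d * m + e * m′) ≡ s * (d * m) + s * e * m′
  expand = solve-∀

  productRule : ∀ j → deriv (signed (even (toℕ j)) (M zero j *ₚ det (minor j M))) x ≡
    firstRow j + sum λ k → otherRow k j
  productRule j = begin
    deriv (signed (even (toℕ j)) (M zero j *ₚ det (minor j M))) x
      ≡⟨ deriv-signed (even (toℕ j)) (M zero j *ₚ det (minor j M)) x ⟩
    sgn (toℕ j) * deriv (M zero j *ₚ det (minor j M)) x
      ≡⟨ cong (sgn (toℕ j) *_) (deriv-* (M zero j) (det (minor j M)) x) ⟩
    sgn (toℕ j) * (D zero j * eval (det (minor j M)) x + E zero j * deriv (det (minor j M)) x)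
      ≡⟨ cong₂ (λ y z → sgn (toℕ j) * (D zero j * y + E zero j * z))
           (eval-det (minor j M) x) (deriv-det (minor j M) x) ⟩
    sgn (toℕ j) * (D zero j * detℤ (minor j E) + E zero j * sum minorDerivs)
      ≡⟨ expand (sgn (toℕ j)) (D zero j) (detℤ (minor j E)) (E zero j) (sum minorDerivs) ⟩
    firstRow j + sgn (toℕ j) * E zero j * sum minorDerivs
      ≡⟨ cong (λ z → firstRow j + z) (trans (*-distribˡ-sum (sgn (toℕ j) * E zero j) minorDerivs)
           (sum-cong-≗ λ k → *-assoc (sgn (toℕ j)) (E zero j) (minorDerivs k))) ⟩
    firstRow j + (sum λ k → otherRow k j) ∎
    where
    minorDerivs : Fin N → ℤ
    minorDerivs k = detℤ (setRow (minor j E) k (D (suc k) ∘ punchIn j))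

-- Vanishing of integers and of integer polynomials

i*j≡0∧i≢0⇒j≡0 : ∀ i j → i ≢ 0ℤ → i * j ≡ 0ℤ → j ≡ 0ℤ
i*j≡0∧i≢0⇒j≡0 i j i≢0 i*j≡0 with i*j≡0⇒i≡0∨j≡0 i i*j≡0
... | inj₁ i≡0 = contradiction i≡0 i≢0
... | inj₂ j≡0 = j≡0

-- At `u` = |m| the divisor |m| + 2 exceeds |m|, which a nonzero `m` does not allow. The factor `x`
-- is carried along because the evaluation points used later are multiples of `x`.
∣-allLarge⇒≡0 : ∀ x → x ≢ 0ℤ → ∀ m → (∀ u → ∃ λ q → m ≡ x * pos (suc (suc u)) * q) → m ≡ 0ℤ
∣-allLarge⇒≡0 x x≢0 m multiple with abs m in ∣m∣≡ | multiple (abs m)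
... | zero  | _     = ∣i∣≡0⇒i≡0 ∣m∣≡
... | suc n | q , m≡ = contradiction
  (divides (abs (x * q)) (trans (sym ∣m∣≡)
    (trans (cong abs (trans m≡ (rotate x (pos (suc (suc (suc n)))) q))) (abs-* (x * q) _))))
  (>⇒∤ (ℕ.m≤n⇒m≤1+n (ℕ.n<1+n (suc n))))
  where
  rotate : ∀ x y z → x * y * z ≡ x * z * y
  rotate = solve-∀

-- Descent: the factor is at least 2, so a bound n + 1 on |d i| gives the bound n on the next term.
-- The induction is on the bound, with the index left free.
infinitelyDivisible⇒≡0 : ∀ v (d : ℕ → ℤ) → (∀ i → d i ≡ pos (suc (suc v)) * d (suc i)) → ∀ i → d i ≡ 0ℤ
infinitelyDivisible⇒≡0 v d step i = ∣i∣≡0⇒i≡0 (bounded (abs (d i)) i ℕ.≤-refl)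
  where
  shrink : ∀ n a → suc (suc v) ℕ.* a ℕ.≤ suc n → a ℕ.≤ n
  shrink n zero    _ = z≤n
  shrink n (suc a) (s≤s p) = ℕ.≤-trans (ℕ.m≤n+m (suc a) a)
    (ℕ.≤-trans (ℕ.+-monoʳ-≤ a (ℕ.m≤m+n (suc a) _)) p)

  bounded : ∀ n i → abs (d i) ℕ.≤ n → abs (d i) ≡ 0
  bounded zero    i ∣di∣≤0 = ℕ.n≤0⇒n≡0 ∣di∣≤0
  bounded (suc n) i ∣di∣≤ = begin
    abs (d i)                        ≡⟨ ∣step∣ ⟩
    suc (suc v) ℕ.* abs (d (suc i))  ≡⟨ cong (suc (suc v) ℕ.*_) (bounded n (suc i)
                                          (shrink n (abs (d (suc i))) (subst (ℕ._≤ suc n) ∣step∣ ∣di∣≤))) ⟩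
    suc (suc v) ℕ.* 0                ≡⟨ ℕ.*-zeroʳ (suc (suc v)) ⟩
    0                                ∎
    where
    ∣step∣ : abs (d i) ≡ suc (suc v) ℕ.* abs (d (suc i))
    ∣step∣ = trans (cong abs (step i)) (abs-* (pos (suc (suc v))) (d (suc i)))

-- A root x divides the constant term, so arbitrarily large roots make that term zero; dividing by x
-- then leaves a shorter polynomial with the same roots.
coeff≡0 : ∀ p → (∀ v → eval p (pos (suc v)) ≡ 0ℤ) → ∀ k → coeff p k ≡ 0ℤ
coeff≡0 []      p≡0 k = refl
coeff≡0 (a ∷ p) p≡0 = λ { zero → a≡0 ; (suc k) → coeff≡0 p tail≡0 k }
  where
  isolate : ∀ a x y → a ≡ a + x * y + 1ℤ * x * - y
  isolate = solve-∀

  divisible : ∀ u → ∃ λ q → a ≡ 1ℤ * pos (suc (suc u)) * q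
  divisible u = - y , trans (isolate a x y)
    (trans (cong (_+ 1ℤ * x * - y) (p≡0 (suc u))) (+-identityˡ (1ℤ * x * - y)))
    where
    x = pos (suc (suc u))
    y = eval p x

  a≡0 : a ≡ 0ℤ
  a≡0 = ∣-allLarge⇒≡0 1ℤ (λ ()) a divisible

  tail≡0 : ∀ v → eval p (pos (suc v)) ≡ 0ℤ
  tail≡0 v = i*j≡0∧i≢0⇒j≡0 (pos (suc v)) (eval p (pos (suc v))) (λ ()) (begin
    pos (suc v) * eval p (pos (suc v))       ≡⟨ +-identityˡ (pos (suc v) * eval p (pos (suc v))) ⟨
    0ℤ + pos (suc v) * eval p (pos (suc v))  ≡⟨ cong (_+ pos (suc v) * eval p (pos (suc v))) a≡0 ⟨
    a + pos (suc v) * eval p (pos (suc v))   ≡⟨ p≡0 v ⟩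
    0ℤ                                       ∎)

coeff-+ : ∀ p q k → coeff (p +ₚ q) k ≡ coeff p k + coeff q k
coeff-+ []      q       k       = sym (+-identityˡ (coeff q k))
coeff-+ (a ∷ p) []      k       = sym (+-identityʳ (coeff (a ∷ p) k))
coeff-+ (a ∷ p) (b ∷ q) zero    = refl
coeff-+ (a ∷ p) (b ∷ q) (suc k) = coeff-+ p q k

coeff-scale : ∀ c p k → coeff (scaleₚ c p) k ≡ c * coeff p k
coeff-scale c []      k       = sym (*-zeroʳ c)
coeff-scale c (a ∷ p) zero    = refl
coeff-scale c (a ∷ p) (suc k) = coeff-scale c p k

infixl 6 _-ₚ_

_-ₚ_ : Poly → Poly → Poly
p -ₚ q = p +ₚ negₚ q

eval-minus : ∀ p q x → eval (p -ₚ q) x ≡ eval p x - eval q x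
eval-minus p q x = trans (eval-+ p (negₚ q) x)
  (cong (λ z → eval p x + z) (trans (eval-scale -1ℤ q x) (-1*i≡-i (eval q x))))

deriv-minus : ∀ p q x → deriv (p -ₚ q) x ≡ deriv p x - deriv q x
deriv-minus p q x = trans (deriv-+ p (negₚ q) x)
  (cong (λ z → deriv p x + z) (trans (deriv-scale -1ℤ q x) (-1*i≡-i (deriv q x))))

coeff-minus : ∀ p q k → coeff (p -ₚ q) k ≡ coeff p k - coeff q k
coeff-minus p q k = trans (coeff-+ p (negₚ q) k)
  (cong (λ z → coeff p k + z) (trans (coeff-scale -1ℤ q k) (-1*i≡-i (coeff q k))))

eval-≡⇒coeff-≡ : ∀ p q → (∀ v → eval p (pos (suc v)) ≡ eval q (pos (suc v))) → ∀ k → coeff p k ≡ coeff q k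
eval-≡⇒coeff-≡ p q p≡q k = i-j≡0⇒i≡j (coeff p k) (coeff q k) (trans (sym (coeff-minus p q k))
  (coeff≡0 (p -ₚ q) (λ v → trans (eval-minus p q (pos (suc v))) (i≡j⇒i-j≡0 (p≡q v))) k))

eval-mod : ∀ p x → ∃ λ q → eval p x ≡ eval p 0ℤ + x * q
eval-mod []      x = 0ℤ , sym (trans (+-identityˡ (x * 0ℤ)) (*-zeroʳ x))
eval-mod (a ∷ p) x = eval p x , cong (_+ x * eval p x) (sym (+-identityʳ a))

-- If k e s + t (e′ s − e s′) vanishes, then t divides k e(0) s(0); when this holds for all
-- t = x u with u ≥ 2, the constant term of e is zero, and dividing e by t raises k by one.
wronskian-vanishes : ∀ x → x ≢ 0ℤ → ∀ s → eval s 0ℤ ≢ 0ℤ → ∀ k e →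
  (∀ u → let t = x * pos (suc (suc u)) in
    pos (suc k) * (eval e t * eval s t) + t * (deriv e t * eval s t - eval e t * deriv s t) ≡ 0ℤ) →
  ∀ y → eval e y ≡ 0ℤ
wronskian-vanishes x x≢0 s s₀≢0 k []      hyp y = refl
wronskian-vanishes x x≢0 s s₀≢0 k (a ∷ e) hyp y = begin
  a + y * eval e y  ≡⟨ cong₂ (λ b z → b + y * z) a≡0 (wronskian-vanishes x x≢0 s s₀≢0 (suc k) e hyp′ y) ⟩
  0ℤ + y * 0ℤ       ≡⟨ trans (+-identityˡ (y * 0ℤ)) (*-zeroʳ y) ⟩
  0ℤ                ∎
  where
  s₀ = eval s 0ℤ

  -- With s(t) = c + tq, the left side of the hypothesis is kac plus a multiple of t; solving for
  -- kac exhibits t as a divisor.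
  isolate : ∀ k a c t e q w →
    k * (a * c) ≡ (k * ((a + t * e) * (c + t * q)) + t * w) + t * - (k * (a * q + e * c + t * e * q) + w)
  isolate = solve-∀

  divisible : ∀ u → ∃ λ q → pos (suc k) * (a * s₀) ≡ x * pos (suc (suc u)) * q
  divisible u with eval-mod s (x * pos (suc (suc u)))
  ... | q , s≡ = - z , (begin
    pos (suc k) * (a * s₀)
      ≡⟨ isolate (pos (suc k)) a s₀ t (eval e t) q w ⟩
    pos (suc k) * ((a + t * eval e t) * (s₀ + t * q)) + t * w + t * - z
      ≡⟨ cong (λ σ → pos (suc k) * ((a + t * eval e t) * σ) + t * w + t * - z) s≡ ⟨
    pos (suc k) * ((a + t * eval e t) * eval s t) + t * w + t * - z
      ≡⟨ cong (_+ t * - z) (hyp u) ⟩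
    0ℤ + t * - z
      ≡⟨ +-identityˡ (t * - z) ⟩
    t * - z ∎)
    where
    t = x * pos (suc (suc u))
    w = deriv (a ∷ e) t * eval s t - eval (a ∷ e) t * deriv s t
    z = pos (suc k) * (a * q + eval e t * s₀ + t * eval e t * q) + w

  a≡0 : a ≡ 0ℤ
  a≡0 = i*j≡0∧i≢0⇒j≡0 s₀ a s₀≢0 (trans (*-comm s₀ a)
    (i*j≡0∧i≢0⇒j≡0 (pos (suc k)) (a * s₀) (λ ())
      (∣-allLarge⇒≡0 x x≢0 (pos (suc k) * (a * s₀)) divisible)))

  -- Once the constant term is zero, the polynomial is te with derivative e + te′. The extra e is
  -- what raises k by one, and the common factor t can be cancelled.
  factor : ∀ k t e e′ s s′ →
    t * ((1ℤ + k) * (e * s) + t * (e′ * s - e * s′)) ≡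
    k * ((0ℤ + t * e) * s) + t * ((e + t * e′) * s - (0ℤ + t * e) * s′)
  factor = solve-∀

  hyp′ : ∀ u → let t = x * pos (suc (suc u)) in
    pos (suc (suc k)) * (eval e t * eval s t) + t * (deriv e t * eval s t - eval e t * deriv s t) ≡ 0ℤ
  hyp′ u = i*j≡0∧i≢0⇒j≡0 t _ (λ t≡0 → contradiction (i*j≡0∧i≢0⇒j≡0 x (pos (suc (suc u))) x≢0 t≡0) λ ())
    (trans (factor (pos (suc k)) t (eval e t) (deriv e t) (eval s t) (deriv s t))
      (trans (cong (λ b → pos (suc k) * ((b + t * eval e t) * eval s t) +
                t * ((eval e t + t * deriv e t) * eval s t - (b + t * eval e t) * deriv s t)) (sym a≡0))
        (hyp u)))
    where
    t = x * pos (suc (suc u))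

-- The difference d = p - q satisfies d′q - dq′ = p′q - pq′ = 0 at these points and has constant
-- term zero. Writing d = te turns this into the hypothesis of `wronskian-vanishes` with leading
-- factor 1.
wronskian≡0⇒eval-≡ : ∀ x → x ≢ 0ℤ → ∀ p q → eval q 0ℤ ≢ 0ℤ → eval p 0ℤ ≡ eval q 0ℤ →
  (∀ u → let t = x * pos (suc (suc u)) in deriv p t * eval q t ≡ eval p t * deriv q t) →
  ∀ y → eval p y ≡ eval q y
wronskian≡0⇒eval-≡ x x≢0 p q q₀≢0 p₀≡q₀ wronskian y =
  i-j≡0⇒i≡j (eval p y) (eval q y) (trans (sym (eval-minus p q y))
    (vanishes (p -ₚ q) (trans (eval-minus p q 0ℤ) (i≡j⇒i-j≡0 p₀≡q₀)) difference))
  where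
  regroup : ∀ p q p′ q′ → (p′ - q′) * q - (p - q) * q′ ≡ p′ * q - p * q′
  regroup = solve-∀

  difference : ∀ u → let t = x * pos (suc (suc u)) in
    deriv (p -ₚ q) t * eval q t - eval (p -ₚ q) t * deriv q t ≡ 0ℤ
  difference u = trans
    (cong₂ (λ d e → d * eval q t - e * deriv q t) (deriv-minus p q t) (eval-minus p q t))
    (trans (regroup (eval p t) (eval q t) (deriv p t) (deriv q t)) (i≡j⇒i-j≡0 (wronskian u)))
    where
    t = x * pos (suc (suc u))

  expand : ∀ t e e′ q q′ → 1ℤ * (e * q) + t * (e′ * q - e * q′) ≡ (e + t * e′) * q - (0ℤ + t * e) * q′
  expand = solve-∀

  vanishes : ∀ d → eval d 0ℤ ≡ 0ℤ → (∀ u → let t = x * pos (suc (suc u)) in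
    deriv d t * eval q t - eval d t * deriv q t ≡ 0ℤ) → eval d y ≡ 0ℤ
  vanishes []      d₀≡0 hyp = refl
  vanishes (a ∷ e) d₀≡0 hyp = trans
    (cong₂ (λ b z → b + y * z) a≡0 (wronskian-vanishes x x≢0 q q₀≢0 0 e hyp′ y))
    (trans (+-identityˡ (y * 0ℤ)) (*-zeroʳ y))
    where
    a≡0 : a ≡ 0ℤ
    a≡0 = trans (sym (+-identityʳ a)) d₀≡0

    hyp′ : ∀ u → let t = x * pos (suc (suc u)) in
      1ℤ * (eval e t * eval q t) + t * (deriv e t * eval q t - eval e t * deriv q t) ≡ 0ℤ
    hyp′ u = trans (expand t (eval e t) (deriv e t) (eval q t) (deriv q t))
      (trans (cong (λ b → deriv (a ∷ e) t * eval q t - (b + t * eval e t) * deriv q t) (sym a≡0)) (hyp u))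
      where
      t = x * pos (suc (suc u))

-- Matrix products and traces

infixl 7 _·_

_·_ : ∀ {N} → Matrix ℤ N → Matrix ℤ N → Matrix ℤ N
(A · B) r s = sum λ q → A r q * B q s

trace : ∀ {N} → Matrix ℤ N → ℤ
trace A = sum λ r → A r r

sum-*-assoc : ∀ {m n} (a : Fin m → ℤ) (B : Fin m → Fin n → ℤ) (c : Fin n → ℤ) →
  sum (λ q → sum (λ p → a p * B p q) * c q) ≡ sum (λ p → a p * sum λ q → B p q * c q)
sum-*-assoc a B c = begin
  sum (λ q → sum (λ p → a p * B p q) * c q)
    ≡⟨ sum-cong-≗ (λ q → *-distribʳ-sum (c q) (λ p → a p * B p q)) ⟩
  sum (λ q → sum λ p → a p * B p q * c q)
    ≡⟨ sum-cong-≗ (λ q → sum-cong-≗ λ p → *-assoc (a p) (B p q) (c q)) ⟩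
  sum (λ q → sum λ p → a p * (B p q * c q))
    ≡⟨ sum-linear-comm a (λ p q → B p q * c q) ⟩
  sum (λ p → a p * sum λ q → B p q * c q) ∎

·-assoc : ∀ {N} (A B C : Matrix ℤ N) r s → ((A · B) · C) r s ≡ (A · (B · C)) r s
·-assoc A B C r s = sum-*-assoc (A r) B (λ q → C q s)

-- Index `i` stands for the exponent i + 1, so index 0 gives the trace of A times the adjugate,
-- which is minus the derivative of the determinant.
power⁺ : ∀ {N} → Matrix ℤ N → ℕ → Matrix ℤ N
power⁺ A zero    = A
power⁺ A (suc i) = power⁺ A i · A

δ-sym : ∀ {n} (i j : Fin n) → δ i j ≡ δ j i
δ-sym zero    zero    = refl
δ-sym zero    (suc j) = refl
δ-sym (suc i) zero    = refl
δ-sym (suc i) (suc j) = δ-sym i j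

pencilℤ : ∀ {N} → ℤ → ℤ → Matrix ℤ N → Matrix ℤ N
pencilℤ x t A r c = x * δ r c - t * A r c

-- The assumption (xI - tA)B = DI rearranges to tAB + DI = xB; multiply by `X` on the left and take
-- traces.
trace-pencil : ∀ {N} x t D (A B X : Matrix ℤ N) →
  (∀ i k → (pencilℤ x t A · B) i k ≡ δ i k * D) →
  t * trace ((X · A) · B) + D * trace X ≡ x * trace (X · B)
trace-pencil x t D A B X pencil·B = begin
  t * trace ((X · A) · B) + D * trace X
    -- The trace of `X` is rewritten as that of X times the identity, so that both terms are double
    -- sums over the same indices.
    ≡⟨ cong₂ (λ y z → t * y + D * z) (sum-cong-≗ λ r → ·-assoc X A B r r)
         (sum-cong-≗ λ r → sym (sum-δ (X r) r)) ⟩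
  t * sum (λ r → sum λ q → X r q * (A · B) q r) + D * sum (λ r → sum λ q → X r q * δ q r)
    ≡⟨ cong₂ _+_ (scale₂ t λ r q → X r q * (A · B) q r) (scale₂ D λ r q → X r q * δ q r) ⟨
  sum (λ r → sum λ q → t * (X r q * (A · B) q r)) + sum (λ r → sum λ q → D * (X r q * δ q r))
    ≡⟨ ∑-distrib-+ (λ r → sum λ q → t * (X r q * (A · B) q r)) (λ r → sum λ q → D * (X r q * δ q r)) ⟨
  sum (λ r → sum (λ q → t * (X r q * (A · B) q r)) + sum (λ q → D * (X r q * δ q r)))
    ≡⟨ sum-cong-≗ (λ r → trans
         (sym (∑-distrib-+ (λ q → t * (X r q * (A · B) q r)) (λ q → D * (X r q * δ q r))))
         (sum-cong-≗ λ q → trans (factor t D (X r q) ((A · B) q r) (δ q r))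
           (trans (cong (X r q *_) (entry q r)) (rotate (X r q) x (B q r))))) ⟩
  sum (λ r → sum λ q → x * (X r q * B q r))
    ≡⟨ scale₂ x (λ r q → X r q * B q r) ⟩
  x * trace (X · B) ∎
  where
  scale₂ : ∀ {m n} a (f : Fin m → Fin n → ℤ) → sum (λ r → sum λ q → a * f r q) ≡ a * sum (λ r → sum λ q → f r q)
  scale₂ a f = trans (sum-cong-≗ λ r → sum-scale a (f r)) (sum-scale a λ r → sum (f r))

  factor : ∀ t d a b e → t * (a * b) + d * (a * e) ≡ a * (t * b + e * d)
  factor = solve-∀

  rotate : ∀ a x b → a * (x * b) ≡ x * (a * b)
  rotate = solve-∀

  expand : ∀ x t a b e → t * (a * b) + (x * e - t * a) * b ≡ x * (b * e)
  expand = solve-∀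

  entry : ∀ q r → t * (A · B) q r + δ q r * D ≡ x * B q r
  entry q r = begin
    t * (A · B) q r + δ q r * D
      ≡⟨ cong₂ _+_ (sum-scale t (λ j → A q j * B j r)) (pencil·B q r) ⟨
    sum (λ j → t * (A q j * B j r)) + (pencilℤ x t A · B) q r
      ≡⟨ ∑-distrib-+ (λ j → t * (A q j * B j r)) (λ j → pencilℤ x t A q j * B j r) ⟨
    sum (λ j → t * (A q j * B j r) + pencilℤ x t A q j * B j r)
      ≡⟨ sum-cong-≗ (λ j → trans (expand x t (A q j) (B j r) (δ q j))
           (cong (λ e → x * (B j r * e)) (δ-sym q j))) ⟩
    sum (λ j → x * (B j r * δ j q))
      ≡⟨ trans (sum-scale x λ j → B j r * δ j q) (cong (x *_) (sum-δ (λ j → B j r) q)) ⟩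
    x * B q r ∎

-- The trace criterion for cospectrality

-- The entries of xI - tA as polynomials in t, with x a fixed integer; derivatives below are
-- therefore with respect to t.
pencil : ∀ {N} → ℤ → Matrix ℤ N → Matrix Poly N
pencil x A r c = x * δ r c ∷ - A r c ∷ []

evalMatrix-pencil : ∀ {N} x (A : Matrix ℤ N) t r c → evalMatrix (pencil x A) t r c ≡ pencilℤ x t A r c
evalMatrix-pencil x A t r c = simplify (x * δ r c) (A r c) t
  where
  simplify : ∀ e a t → e + t * (- a + t * 0ℤ) ≡ e - t * a
  simplify = solve-∀

-- Jacobi's formula: differentiating row `k` in t gives minus row `k` of `A`, and expanding along
-- that replaced row pairs it with column `k` of the adjugate.
deriv-det-pencil : ∀ {N} x (A : Matrix ℤ N) t →
  deriv (det (pencil x A)) t ≡ - trace (A · adjugate (evalMatrix (pencil x A) t))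
deriv-det-pencil x A t = begin
  deriv (det (pencil x A)) t
    ≡⟨ deriv-det (pencil x A) t ⟩
  sum (λ k → detℤ (setRow E k (derivMatrix (pencil x A) t k)))
    ≡⟨ sum-cong-≗ (λ k → detℤ-setRow E k (derivMatrix (pencil x A) t k)) ⟩
  sum (λ k → sum λ j → derivMatrix (pencil x A) t k j * adjugate E j k)
    ≡⟨ sum-cong-≗ (λ k → trans (sum-cong-≗ λ j → simplify (A k j) t (adjugate E j k))
         (sum-neg λ j → A k j * adjugate E j k)) ⟩
  sum (λ k → - (A · adjugate E) k k)
    ≡⟨ sum-neg (λ k → (A · adjugate E) k k) ⟩
  - trace (A · adjugate E) ∎
  where
  E = evalMatrix (pencil x A) t

  simplify : ∀ a t b → (- a + t * 0ℤ + t * (0ℤ + t * 0ℤ)) * b ≡ - (a * b)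
  simplify = solve-∀

det-pencil-trace : ∀ {N} x t (A X : Matrix ℤ N) →
  let B = adjugate (evalMatrix (pencil x A) t) in
  t * trace ((X · A) · B) + eval (det (pencil x A)) t * trace X ≡ x * trace (X · B)
det-pencil-trace x t A X = trace-pencil x t (eval (det (pencil x A)) t) A (adjugate E) X λ i k → begin
  sum (λ j → pencilℤ x t A i j * adjugate E j k)
    ≡⟨ sum-cong-≗ (λ j → cong (_* adjugate E j k) (evalMatrix-pencil x A t i j)) ⟨
  sum (λ j → E i j * adjugate E j k)
    ≡⟨ *-adjugate E i k ⟩
  δ i k * detℤ E
    ≡⟨ cong (δ i k *_) (eval-det (pencil x A) t) ⟨
  δ i k * eval (det (pencil x A)) t ∎
  where
  E = evalMatrix (pencil x A) t

-- Only the diagonal entry of the first row contributes, so each size adds one factor x. This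
-- determinant is the common value of both pencils at t = 0.
detℤ-scalar≢0 : ∀ N x → x ≢ 0ℤ → detℤ {N} (λ r c → x * δ r c) ≢ 0ℤ
detℤ-scalar≢0 zero    x x≢0 ()
detℤ-scalar≢0 (suc N) x x≢0 det≡0 = detℤ-scalar≢0 N x x≢0
  (i*j≡0∧i≢0⇒j≡0 x (detℤ {N} λ r c → x * δ r c) x≢0 (begin
  x * detℤ {N} (λ r c → x * δ r c)
    ≡⟨ diagonal x (detℤ {N} λ r c → x * δ r c) ⟩
  1ℤ * (x * 1ℤ * detℤ {N} (λ r c → x * δ r c)) + 0ℤ
    ≡⟨ cong (λ z → 1ℤ * (x * 1ℤ * detℤ {N} (λ r c → x * δ r c)) + z)
         (sum-zero {N} λ j → offDiagonal (sgn (suc (toℕ j))) x _) ⟨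
  detℤ {suc N} (λ r c → x * δ r c)
    ≡⟨ det≡0 ⟩
  0ℤ ∎))
  where
  diagonal : ∀ x d → x * d ≡ 1ℤ * (x * 1ℤ * d) + 0ℤ
  diagonal = solve-∀

  offDiagonal : ∀ s x d → s * (x * 0ℤ * d) ≡ 0ℤ
  offDiagonal = solve-∀

eval-det-pencil-0 : ∀ {N} x (A : Matrix ℤ N) → eval (det (pencil x A)) 0ℤ ≡ detℤ {N} (λ r c → x * δ r c)
eval-det-pencil-0 {N} x A = trans (eval-det (pencil x A) 0ℤ) (detℤ-cong {N} λ r c → +-identityʳ (x * δ r c))

-- The two polynomials have different variables, but the first at x and the second at t = 1 are
-- determinants of the same integer matrix.
eval-charPoly : ∀ {N} (A : Matrix ℤ N) x → eval (charPoly A) x ≡ eval (det (pencil x A)) 1ℤ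
eval-charPoly {N} A x = trans (eval-det xI-A x)
  (trans (detℤ-cong {N} λ r c → entry (does (toℕ r ℕ.≟ toℕ c)) (A r c)) (sym (eval-det (pencil x A) 1ℤ)))
  where
  xI-A : Matrix Poly N
  xI-A r c = if does (toℕ r ℕ.≟ toℕ c) then - A r c ∷ 1ℤ ∷ [] else - A r c ∷ []

  diagonal : ∀ a x → - a + x * (1ℤ + x * 0ℤ) ≡ x * 1ℤ + 1ℤ * (- a + 1ℤ * 0ℤ)
  diagonal = solve-∀

  offDiagonal : ∀ a x → - a + x * 0ℤ ≡ x * 0ℤ + 1ℤ * (- a + 1ℤ * 0ℤ)
  offDiagonal = solve-∀

  entry : ∀ b a → eval (if b then - a ∷ 1ℤ ∷ [] else - a ∷ []) x ≡
    x * (if b then 1ℤ else 0ℤ) + 1ℤ * (- a + 1ℤ * 0ℤ)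
  entry true  a = diagonal a x
  entry false a = offDiagonal a x

traces-≡⇒det-pencil-≡ : ∀ {N} (A A′ : Matrix ℤ N) → (∀ i → trace (power⁺ A i) ≡ trace (power⁺ A′ i)) →
  ∀ x → x ≢ 0ℤ → ∀ y → eval (det (pencil x A)) y ≡ eval (det (pencil x A′)) y
traces-≡⇒det-pencil-≡ {N} A A′ traces x x≢0 = wronskian≡0⇒eval-≡ x x≢0 R R′
  (subst (_≢ 0ℤ) (sym (eval-det-pencil-0 x A′)) (detℤ-scalar≢0 N x x≢0))
  (trans (eval-det-pencil-0 x A) (sym (eval-det-pencil-0 x A′)))
  wronskian
  where
  R R′ : Poly
  R  = det (pencil x A)
  R′ = det (pencil x A′)

  -- Multiplying the recurrences by s and r and subtracting cancels the common trace p.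
  combine-steps : ∀ x t s r b b₁ c c₁ p → t * b₁ + r * p ≡ x * b → t * c₁ + s * p ≡ x * c →
    x * (s * b - r * c) ≡ t * (s * b₁ - r * c₁)
  combine-steps x t s r b b₁ c c₁ p eq-b eq-c = begin
    x * (s * b - r * c)                                ≡⟨ distribute x s r b c ⟩
    s * (x * b) - r * (x * c)                          ≡⟨ cong₂ (λ y z → s * y - r * z) eq-b eq-c ⟨
    s * (t * b₁ + r * p) - r * (t * c₁ + s * p)        ≡⟨ collect t s r b₁ c₁ p ⟩
    t * (s * b₁ - r * c₁)                              ∎
    where
    distribute : ∀ x s r b c → x * (s * b - r * c) ≡ s * (x * b) - r * (x * c)
    distribute = solve-∀
    collect : ∀ t s r b c p → s * (t * b + r * p) - r * (t * c + s * p) ≡ t * (s * b - r * c)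
    collect = solve-∀

  module _ (u : ℕ) where
    t = x * pos (suc (suc u))
    B  = adjugate (evalMatrix (pencil x A) t)
    B′ = adjugate (evalMatrix (pencil x A′) t)

    d : ℕ → ℤ
    d i = eval R′ t * trace (power⁺ A i · B) - eval R t * trace (power⁺ A′ i · B′)

    d-step : ∀ i → d i ≡ pos (suc (suc u)) * d (suc i)
    -- Since t is x times u + 2, cancelling x leaves an integer factor of at least 2, as the descent
    -- requires.
    d-step i = *-cancelˡ-≡ x (d i) _ {{≢-nonZero x≢0}} (trans
      (combine-steps x t (eval R′ t) (eval R t) (trace (power⁺ A i · B)) (trace (power⁺ A (suc i) · B))
        (trace (power⁺ A′ i · B′)) (trace (power⁺ A′ (suc i) · B′)) (trace (power⁺ A i))
        (det-pencil-trace x t A (power⁺ A i))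
        (trans (cong (λ p → t * trace (power⁺ A′ (suc i) · B′) + eval R′ t * p) (traces i))
          (det-pencil-trace x t A′ (power⁺ A′ i))))
      (*-assoc x (pos (suc (suc u))) (d (suc i))))

    negate : ∀ b c r s → - b * s - r * - c ≡ - (s * b - r * c)
    negate = solve-∀

    wronskian : deriv R t * eval R′ t ≡ eval R t * deriv R′ t
    wronskian = i-j≡0⇒i≡j _ _ (begin
      deriv R t * eval R′ t - eval R t * deriv R′ t
        ≡⟨ cong₂ (λ y z → y * eval R′ t - eval R t * z) (deriv-det-pencil x A t) (deriv-det-pencil x A′ t) ⟩
      - trace (A · B) * eval R′ t - eval R t * - trace (A′ · B′)
        ≡⟨ negate (trace (A · B)) (trace (A′ · B′)) (eval R t) (eval R′ t) ⟩
      - d 0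
        ≡⟨ cong -_ (infinitelyDivisible⇒≡0 u d d-step 0) ⟩
      0ℤ ∎)

traces-≡⇒Cospectral : ∀ {N} (A A′ : Matrix ℤ N) →
  (∀ i → trace (power⁺ A i) ≡ trace (power⁺ A′ i)) → Cospectral A A′
traces-≡⇒Cospectral A A′ traces = eval-≡⇒coeff-≡ (charPoly A) (charPoly A′) λ v →
  trans (eval-charPoly A (pos (suc v)))
    (trans (traces-≡⇒det-pencil-≡ A A′ traces (pos (suc v)) (λ ()) 1ℤ)
      (sym (eval-charPoly A′ (pos (suc v)))))

-- Block matrices with commuting blocks

Commutes : ∀ {N} → Matrix ℤ N → Matrix ℤ N → Set
Commutes A B = ∀ r s → (A · B) r s ≡ (B · A) r s

Commutes-· : ∀ {N} (A B C : Matrix ℤ N) → Commutes A C → Commutes B C → Commutes (A · B) C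
Commutes-· A B C AC≡CA BC≡CB r s = begin
  ((A · B) · C) r s  ≡⟨ ·-assoc A B C r s ⟩
  (A · (B · C)) r s  ≡⟨ sum-cong-≗ (λ q → cong (A r q *_) (BC≡CB q s)) ⟩
  (A · (C · B)) r s  ≡⟨ ·-assoc A C B r s ⟨
  ((A · C) · B) r s  ≡⟨ sum-cong-≗ (λ q → cong (_* B q s) (AC≡CA r q)) ⟩
  ((C · A) · B) r s  ≡⟨ ·-assoc C A B r s ⟩
  (C · (A · B)) r s  ∎

Commutes-sum : ∀ {K N} (A : Fin K → Matrix ℤ N) (C : Matrix ℤ N) → (∀ l → Commutes (A l) C) →
  Commutes (λ r s → sum λ l → A l r s) C
Commutes-sum A C comm r s = begin
  sum (λ q → sum (λ l → A l r q) * C q s)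
    ≡⟨ sum-cong-≗ (λ q → *-distribʳ-sum (C q s) (λ l → A l r q)) ⟩
  sum (λ q → sum λ l → A l r q * C q s)
    ≡⟨ ∑-comm (λ q l → A l r q * C q s) ⟩
  sum (λ l → (A l · C) r s)
    ≡⟨ sum-cong-≗ (λ l → comm l r s) ⟩
  sum (λ l → (C · A l) r s)
    ≡⟨ ∑-comm (λ q l → C r q * A l q s) ⟨
  sum (λ q → sum λ l → C r q * A l q s)
    ≡⟨ sum-cong-≗ (λ q → sum-scale (C r q) (λ l → A l q s)) ⟩
  sum (λ q → C r q * sum λ l → A l q s) ∎

BlockMatrix : ℕ → ℕ → Set
BlockMatrix n m = Fin n → Fin n → Matrix ℤ m

-- The index is split as in `adjMatrix`, which makes the adjacency matrix of a clustered graph a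
-- flattening by definition.
flatten : ∀ {n m} → BlockMatrix n m → Matrix ℤ (n ℕ.* m)
flatten {n} {m} W k l = W (quotient {n} m k) (quotient {n} m l) (remainder {n} m k) (remainder {n} m l)

blockPower⁺ : ∀ {n m} → BlockMatrix n m → ℕ → BlockMatrix n m
blockPower⁺ W zero            = W
blockPower⁺ W (suc k) i j α β = sum λ l → (blockPower⁺ W k i l · W l j) α β

blockTranspose : ∀ {n m} → BlockMatrix n m → BlockMatrix n m
blockTranspose W i j α β = W i j β α

sum-splitAt : ∀ m {n} (f : Fin (m ℕ.+ n) → ℤ) → sum f ≡ sum (λ i → f (i ↑ˡ n)) + sum (λ j → f (m ↑ʳ j))
sum-splitAt zero    f = sym (+-identityˡ (sum f))
sum-splitAt (suc m) {n} f = trans (cong (λ z → f zero + z) (sum-splitAt m {n} (f ∘ suc)))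
  (sym (+-assoc (f zero) (sum λ i → f (suc (i ↑ˡ n))) (sum λ j → f (suc (m ↑ʳ j)))))

sum-combine : ∀ n {m} (f : Fin (n ℕ.* m) → ℤ) → sum f ≡ sum {n} λ i → sum λ α → f (combine {n} {m} i α)
sum-combine zero        f = refl
sum-combine (suc n) {m} f = trans (sum-splitAt m {n ℕ.* m} f)
  (cong (λ z → sum (λ α → f (α ↑ˡ (n ℕ.* m))) + z) (sum-combine n {m} λ k → f (m ↑ʳ k)))

sum-remQuot : ∀ n {m} (f : Fin n → Fin m → ℤ) →
  sum (λ k → f (quotient {n} m k) (remainder {n} m k)) ≡ sum λ i → sum λ α → f i α
sum-remQuot n {m} f = begin
  sum (λ k → f (quotient {n} m k) (remainder {n} m k))
    ≡⟨ sum-combine n {m} (λ k → f (quotient {n} m k) (remainder {n} m k)) ⟩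
  sum (λ i → sum λ α → f (quotient {n} m (combine {n} {m} i α)) (remainder {n} m (combine {n} {m} i α)))
    ≡⟨ sum-cong-≗ (λ i → sum-cong-≗ λ α → cong (λ v → f (proj₁ v) (proj₂ v)) (remQuot-combine {n} {m} i α)) ⟩
  sum (λ i → sum λ α → f i α) ∎

-- Block multiplication: the inner sum over all vertices splits into a sum over clusters and one
-- over positions.
power⁺-flatten : ∀ {n m} (W : BlockMatrix n m) k r c →
  power⁺ (flatten W) k r c ≡ flatten (blockPower⁺ W k) r c
power⁺-flatten W zero r c = refl
power⁺-flatten {n} {m} W (suc k) r c = trans
  (sum-cong-≗ λ q → cong (_* flatten W q c) (power⁺-flatten W k r q))
  (sum-remQuot n λ i α → blockPower⁺ W k (quotient {n} m r) i (remainder {n} m r) α *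
    W i (quotient {n} m c) α (remainder {n} m c))

CommutingBlocks : ∀ {n m} → BlockMatrix n m → Set
CommutingBlocks W = ∀ i₁ j₁ i₂ j₂ → Commutes (W i₁ j₁) (W i₂ j₂)

blockPower⁺-commutes : ∀ {n m} (W : BlockMatrix n m) → CommutingBlocks W →
  ∀ k i₁ j₁ i₂ j₂ → Commutes (blockPower⁺ W k i₁ j₁) (W i₂ j₂)
blockPower⁺-commutes W comm zero    i₁ j₁ i₂ j₂ = comm i₁ j₁ i₂ j₂
blockPower⁺-commutes W comm (suc k) i₁ j₁ i₂ j₂ =
  Commutes-sum (λ l → blockPower⁺ W k i₁ l · W l j₁) (W i₂ j₂) λ l →
    Commutes-· (blockPower⁺ W k i₁ l) (W l j₁) (W i₂ j₂)
      (blockPower⁺-commutes W comm k i₁ l i₂ j₂) (comm l j₁ i₂ j₂)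

-- Transposing a product of blocks reverses its order; since each block of a power commutes with the
-- blocks of `W`, the order can be restored.
blockPower⁺-blockTranspose : ∀ {n m} (W : BlockMatrix n m) → CommutingBlocks W →
  ∀ k i j α β → blockPower⁺ (blockTranspose W) k i j α β ≡ blockPower⁺ W k i j β α
blockPower⁺-blockTranspose W comm zero    i j α β = refl
blockPower⁺-blockTranspose W comm (suc k) i j α β = sum-cong-≗ λ l → begin
  sum (λ p → blockPower⁺ (blockTranspose W) k i l α p * W l j β p)
    ≡⟨ sum-cong-≗ (λ p → trans (cong (_* W l j β p) (blockPower⁺-blockTranspose W comm k i l α p))
         (*-comm (blockPower⁺ W k i l p α) (W l j β p))) ⟩
  (W l j · blockPower⁺ W k i l) β α
    ≡⟨ blockPower⁺-commutes W comm k i l l j β α ⟨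
  (blockPower⁺ W k i l · W l j) β α ∎

blockTranspose-Cospectral : ∀ {n m} (W : BlockMatrix n m) → CommutingBlocks W →
  Cospectral (flatten W) (flatten (blockTranspose W))
blockTranspose-Cospectral {n} {m} W comm =
  traces-≡⇒Cospectral (flatten W) (flatten (blockTranspose W)) λ k → sum-cong-≗ λ r → begin
    power⁺ (flatten W) k r r
      ≡⟨ power⁺-flatten W k r r ⟩
    flatten (blockPower⁺ W k) r r
      -- On the diagonal the two positions inside a block coincide, so transposing the block leaves
      -- the entry in place.
      ≡⟨ blockPower⁺-blockTranspose W comm k (quotient {n} m r) (quotient {n} m r) (remainder {n} m r) (remainder {n} m r) ⟨
    flatten (blockPower⁺ (blockTranspose W) k) r r
      ≡⟨ power⁺-flatten (blockTranspose W) k r r ⟨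
    power⁺ (flatten (blockTranspose W)) k r r ∎

-- From neighbourhood counts to commuting adjacency blocks

size-∩ : ∀ {m} (f g : Fin m → Bool) → pos (size (tabulate f ∩ tabulate g)) ≡ sum λ k → b2ℤ (f k) * b2ℤ (g k)
size-∩ {zero}  f g = refl
size-∩ {suc m} f g with f zero | g zero
... | true  | true  = cong (λ z → 1ℤ + z) (size-∩ (f ∘ suc) (g ∘ suc))
... | true  | false = trans (size-∩ (f ∘ suc) (g ∘ suc)) (sym (+-identityˡ _))
... | false | true  = trans (size-∩ (f ∘ suc) (g ∘ suc)) (sym (+-identityˡ _))
... | false | false = trans (size-∩ (f ∘ suc) (g ∘ suc)) (sym (+-identityˡ _))

adjBlocks : ∀ {n m} → ClusteredGraph n m → BlockMatrix n m
adjBlocks G i j α β = b2ℤ (adj G (i , α) (j , β))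

-- A neighbourhood is a row of a block and, by symmetry of adjacency, a column of the opposite
-- block. The two counts are thus the (α, β) entries of the product of the two blocks in either
-- order.
CommutingCondition⇒CommutingBlocks : ∀ {n m} (G : ClusteredGraph n m) →
  CommutingCondition G → CommutingBlocks (adjBlocks G)
CommutingCondition⇒CommutingBlocks G comm i₁ j₁ i₂ j₂ α β = begin
  sum (λ k → W i₁ j₁ α k * W i₂ j₂ k β)
    ≡⟨ sum-cong-≗ (λ k → cong (λ b → W i₁ j₁ α k * b2ℤ b) (adj-sym G (i₂ , k) (j₂ , β))) ⟩
  sum (λ k → W i₁ j₁ α k * W j₂ i₂ β k)
    ≡⟨ size-∩ (λ k → adj G (i₁ , α) (j₁ , k)) (λ k → adj G (j₂ , β) (i₂ , k)) ⟨
  pos (size (nbd G j₁ (i₁ , α) ∩ nbd G i₂ (j₂ , β)))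
    ≡⟨ cong pos (comm i₁ j₁ i₂ j₂ α β) ⟩
  pos (size (nbd G i₁ (j₁ , β) ∩ nbd G j₂ (i₂ , α)))
    ≡⟨ size-∩ (λ k → adj G (j₁ , β) (i₁ , k)) (λ k → adj G (i₂ , α) (j₂ , k)) ⟩
  sum (λ k → W j₁ i₁ β k * W i₂ j₂ α k)
    ≡⟨ sum-cong-≗ (λ k → trans (*-comm (W j₁ i₁ β k) (W i₂ j₂ α k))
         (cong (λ b → W i₂ j₂ α k * b2ℤ b) (adj-sym G (j₁ , β) (i₁ , k)))) ⟩
  sum (λ k → W i₂ j₂ α k * W i₁ j₁ k β) ∎
  where
  W = adjBlocks G

theorem6 : ∀ {n m} (G : ClusteredGraph n m) →
    CommutingCondition G → NormalityCondition G →
    Cospectral (adjMatrix G) (adjMatrix (partialTranspose G))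
theorem6 G commuting _ =
  -- The adjacency matrix of the partial transpose is by definition the flattening of the transposed
  -- blocks, so no conversion is required.
  blockTranspose-Cospectral (adjBlocks G) (CommutingCondition⇒CommutingBlocks G commuting)
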